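{- Let $m$ be an integer with $1\leq m\leq 5$, let $b$ be an odd positive integer, and let $a\ge 0$ and $k$ be integers. If $(k,4m,2^ab,2,2)$ is admissible and $$(k,4m,2^ab,2,2)\notin\{(3,4c,4,2,2),(3,4,4c,2,2)\mid c \text{ is odd}\},$$ then there exists an array of type $I_k(4m,2^ab,2,2)$.
   Context: For an integer $s\ge 1$ let $[s]=\{0,1,\dots,s-1\}$. An orthogonal array OA$(n,k,q,t)$ (size $n$, degree $k$, $q$ levels, strength $t$, $1\le t\leq k$) is an $n\times k$ array with entries from $[q]$ such that in every $n\times t$ submatrix (choice of $t$ columns), every vector of $[q]^t$ appears as a row exactly $n/q^t$ times. An array of type $I_k(m,n,q,t)$ (an $m\times n$ row-column factorial design $q^k$ of strength $t$) is an $m\times n$ array whose cells each contain a vector of $[q]^k$ such that: (i) each vector of $[q]^k$ occurs in exactly $\lambda=mn/q^k$ cells (so $q^k\mid mn$); (ii) for each row of the array, the $n$ vectors in that row are the rows of an OA$(n,k,q,t)$; (iii) for each column of the array, the $m$ vectors in that column are the rows of an OA$(m,k,q,t)$. A 5-tuple $(k,m,n,q,t)$ is admissible if $q^k\mid mn$, there exists an OA$(m,k,q,t)$, and there exists an OA$(n,k,q,t)$. -}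

module Defs where

open import Data.Fin as Fin using (Fin)
import Data.Fin.Properties as Fin
open import Data.Nat using (ℕ; _*_; _^_; _≤_)
open import Data.Nat.Divisibility using (_∣_; _∤_)
open import Data.Product using (_×_; _,_; ∃)
open import Data.Sum using (_⊎_)
open import Data.Vec using (Vec; lookup; tabulate; concat; count)
open import Data.Vec.Properties using (≡-dec)
open import Function using (_∘_)
open import Level using (0ℓ)
open import Relation.Binary.Core using (_Preserves_⟶_)
open import Relation.Binary.Definitions using (DecidableEquality)
open import Relation.Binary.PropositionalEquality using (_≡_)
open import Relation.Unary using (Pred)

Word : ℕ → ℕ → Set
Word q k = Vec (Fin q) k

_≟ʷ_ : ∀ {q k} → DecidableEquality (Word q k)
_≟ʷ_ = ≡-dec Fin._≟_

occurrences : ∀ {q k n} → Word q k → Vec (Word q k) n → ℕ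
occurrences v = count (_≟ʷ v)

-- A strictly increasing c selects t distinct columns in their original order.
select : ∀ {q k t} → (Fin t → Fin k) → Word q k → Word q t
select c w = tabulate (lookup w ∘ c)

-- In both records below "exactly N / qˢ times" is written multiplicatively,
-- which also forces qˢ to divide N.

record IsOA (n k q t : ℕ) (row : Fin n → Word q k) : Set where
  field
    1≤t      : 1 ≤ t
    t≤k      : t ≤ k
    balanced : (c : Fin t → Fin k) → c Preserves Fin._<_ ⟶ Fin._<_ →
               (v : Word q t) →
               occurrences v (tabulate (select c ∘ row)) * q ^ t ≡ n

OA : (n k q t : ℕ) → Set
OA n k q t = ∃ (IsOA n k q t)

record IsTypeI (k m n q t : ℕ) (cell : Fin m → Fin n → Word q k) : Set where
  field
    uniform : (v : Word q k) →
              occurrences v (concat (tabulate λ i → tabulate (cell i))) * q ^ k ≡ m * n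
    rows    : (i : Fin m) → IsOA n k q t (λ j → cell i j)
    columns : (j : Fin n) → IsOA m k q t (λ i → cell i j)

TypeI : (k m n q t : ℕ) → Set
TypeI k m n q t = ∃ (IsTypeI k m n q t)

-- Parameter tuples are ordered (k , m , n , q , t).
Parameters : Set
Parameters = ℕ × ℕ × ℕ × ℕ × ℕ

Admissible : Pred Parameters 0ℓ
Admissible (k , m , n , q , t) = q ^ k ∣ m * n × OA m k q t × OA n k q t

Exceptional : Pred Parameters 0ℓ
Exceptional p = ∃ λ c → 2 ∤ c ×
  (p ≡ (3 , 4 * c , 4 , 2 , 2) ⊎ p ≡ (3 , 4 , 4 * c , 2 , 2))

{-# OPTIONS --safe #-}

-- Doubling: if every column of an I_k(M, N) extends to an OA(M, K, 2, 2) with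
-- K > k, then placing the array next to its copy with coordinate k flipped is
-- an I_{k+1}(M, 2N) whose columns still extend. Thus, for each height 4m, one
-- array with extendable columns yields all large k. The remaining k come from
-- juxtaposing, transposing and truncating small arrays; for the
-- middle range of k, a width 4c is composed of 8's and 12's, which needs c ≥ 2; there
-- c = 1 is excluded by Rao's bound k < 4c or is exceptional. Comparing powers of 2
-- in 2ᵏ ∣ 4m · 2ᵃb shows that admissibility leaves no other k.
module Submission where

open import Defs
import Algebra.Properties.Semiring.Sum as SemiringSum
open import Data.Bool using (Bool; true; false; not; _∧_; _xor_; if_then_else_; T)
open import Data.Bool.Properties using (T-∧; ∧-identityʳ; ∧-conicalˡ; ∧-conicalʳ; xor-assoc; xor-comm; xor-same)
open import Data.Fin as Fin using (Fin; zero; suc; toℕ; fromℕ<; splitAt)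
open import Data.Fin.Properties as Fin using (2↔Bool; toℕ<n; toℕ-fromℕ<)
open import Data.Integer as ℤ using (ℤ; 0ℤ; 1ℤ; -1ℤ)
  renaming (+_ to pos; _+_ to _+ᶻ_; _*_ to _*ᶻ_; _≤_ to _≤ᶻ_)
import Data.Integer.Properties as ℤ
import Data.Integer.Tactic.RingSolver as ℤ
open import Data.List as List using (List; []; _∷_)
import Data.List.Properties as List
open import Data.Nat
open import Data.Nat.Divisibility
import Data.Nat.ListAction as ListAction
import Data.Nat.ListAction.Properties as ListAction
open import Data.Nat.DivMod using (_/_; _%_)
open import Data.Nat.Properties
open import Data.Nat.Tactic.RingSolver using (solve-∀)
open import Data.Product using (_,_; ∃; proj₁; proj₂)
open import Data.Sum using (inj₁; inj₂)
open import Data.Sum.Properties using ([,]-map)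
open import Data.Vec as Vec using (Vec; []; _∷_; lookup; tabulate; concat; count)
open import Data.Vec.Functional using (Vector; _++_)
open import Data.Vec.Properties using (lookup∘tabulate; tabulate-cong; tabulate∘lookup)
open import Function using (_∘_; Equivalence; Inverse)
open import Level using (0ℓ)
open import Relation.Binary.PropositionalEquality
open import Relation.Nullary using (Dec; yes; no; does; contradiction)
open import Relation.Nullary.Decidable using (dec-true; dec-false; map′; _×-dec_; True; toWitness; toWitnessFalse)
open import Relation.Unary using (Pred; _∈_; _∉_)
import Relation.Unary as Unary

open import Algebra.Properties.AbelianGroup ℤ.+-0-abelianGroup using (identityˡ-unique)
open SemiringSum +-*-semiring using (sum; sum-syntax; sum-cong-≗; ∑-distrib-+; ∑-comm; *-distribʳ-sum; sum-replicate-zero)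
module ∑ℤ = SemiringSum ℤ.+-*-semiring
open Inverse 2↔Bool using () renaming (to to bit; from to level; strictlyInverseˡ to bit-level; strictlyInverseʳ to level-bit)

-- Arrays of bit sequences

private
  variable
    A : Set
    k k′ K M N n : ℕ

-- Words are infinite, and a separate k says how many coordinates count. So truncation leaves the
-- cells unchanged, and coordinate k is at hand when doubling flips it.
Bits : Set
Bits = ℕ → Bool

infix 4 _==_
_==_ : Bool → Bool → Bool
x == y = not (x xor y)

⟦_⟧ : Bool → ℕ
⟦ b ⟧ = if b then 1 else 0

-- The last coordinate is compared first, so that `agree (suc k)` unfolds to a test at coordinate k,
-- the one that doubling adds.
agree : ℕ → Bits → Bits → Bool
agree zero    w v = true
agree (suc k) w v = (w k == v k) ∧ agree k w v

-- The bound on q precedes that on p: this is the nesting that `allUpTo?` decides.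
record Strength2 (k : ℕ) (f : Fin n → Bits) : Set where
  field
    pairs : ∀ {q} → q < k → ∀ {p} → p < q → ∀ x y →
            (∑[ j < n ] ⟦ (f j p == x) ∧ (f j q == y) ⟧) * 4 ≡ n
open Strength2

record Uniform (k : ℕ) (X : Fin M → Fin N → Bits) : Set where
  field
    counts : ∀ v → (∑[ i < M ] ∑[ j < N ] ⟦ agree k (X i j) v ⟧) * 2 ^ k ≡ M * N
open Uniform

-- Coordinates k to K − 1, constrained in the columns only, are those that `extend`
-- consumes.
record IsDesign (k K M N : ℕ) (X : Fin M → Fin N → Bits) : Set where
  field
    rows    : ∀ i → Strength2 k (X i)
    columns : ∀ j → Strength2 K (λ i → X i j)
    uniform : Uniform k X

Design : (k K M N : ℕ) → Set
Design k K M N = ∃ (IsDesign k K M N)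

-- Concatenation, translation and single columns

sum-++ : (φ : A → ℕ) (f : Vector A M) (g : Vector A N) →
         sum (φ ∘ (f ++ g)) ≡ sum (φ ∘ f) + sum (φ ∘ g)
sum-++ {M = zero}  φ f g = refl
sum-++ {M = suc M} φ f g = begin
  φ (f zero) + sum (φ ∘ (f ++ g) ∘ suc)                 ≡⟨ cong (φ (f zero) +_) (sum-cong-≗ λ i → cong φ ([,]-map (splitAt M i))) ⟩
  φ (f zero) + sum (φ ∘ ((f ∘ suc) ++ g))               ≡⟨ cong (φ (f zero) +_) (sum-++ φ (f ∘ suc) g) ⟩
  φ (f zero) + (sum (φ ∘ f ∘ suc) + sum (φ ∘ g))        ≡⟨ +-assoc (φ (f zero)) _ _ ⟨
  φ (f zero) + sum (φ ∘ f ∘ suc) + sum (φ ∘ g)          ∎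
  where open ≡-Reasoning

==-xor : ∀ a t x → ((a xor t) == x) ≡ (a == (t xor x))
==-xor a t x = cong not (xor-assoc a t x)

agree-cong : ∀ k {w w′ v v′} → (∀ {c} → c < k → w c ≡ w′ c) → (∀ {c} → c < k → v c ≡ v′ c) →
             agree k w v ≡ agree k w′ v′
agree-cong zero    w≗ v≗ = refl
agree-cong (suc k) w≗ v≗ =
  cong₂ _∧_ (cong₂ _==_ (w≗ ≤-refl) (v≗ ≤-refl)) (agree-cong k (w≗ ∘ m<n⇒m<1+n) (v≗ ∘ m<n⇒m<1+n))

strength2-≤ : {f : Fin n → Bits} → k′ ≤ k → Strength2 k f → Strength2 k′ f
strength2-≤ k′≤k s .pairs q<k′ = s .pairs (≤-trans q<k′ k′≤k)

strength2-++ : {f : Fin M → Bits} {g : Fin N → Bits} → Strength2 k f → Strength2 k g → Strength2 k (f ++ g)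
strength2-++ {M} {N} {f = f} {g} sf sg .pairs {q} q<k {p} p<q x y = begin
  sum (φ ∘ (f ++ g)) * 4              ≡⟨ cong (_* 4) (sum-++ φ f g) ⟩
  (sum (φ ∘ f) + sum (φ ∘ g)) * 4     ≡⟨ *-distribʳ-+ 4 (sum (φ ∘ f)) _ ⟩
  sum (φ ∘ f) * 4 + sum (φ ∘ g) * 4   ≡⟨ cong₂ _+_ (sf .pairs q<k p<q x y) (sg .pairs q<k p<q x y) ⟩
  M + N                               ∎
  where
  open ≡-Reasoning
  φ : Bits → ℕ
  φ w = ⟦ (w p == x) ∧ (w q == y) ⟧

infixl 6 _⊕_
_⊕_ : Bits → Bits → Bits
(w ⊕ t) c = w c xor t c

-- Translation by t permutes the four patterns on each pair of columns.
strength2-⊕ : {f : Fin n → Bits} (t : Bits) → Strength2 k f → Strength2 k (λ j → f j ⊕ t)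
strength2-⊕ {f = f} t s .pairs {q} q<k {p} p<q x y = trans
  (cong (_* 4) (sum-cong-≗ λ j → cong₂ (λ a b → ⟦ a ∧ b ⟧) (==-xor (f j p) (t p) x) (==-xor (f j q) (t q) y)))
  (s .pairs q<k p<q (t p xor x) (t q xor y))

⟦∧⟧-splitʳ : ∀ a b → ⟦ a ∧ (b == true) ⟧ + ⟦ a ∧ (b == false) ⟧ ≡ ⟦ a ⟧
⟦∧⟧-splitʳ false b     = refl
⟦∧⟧-splitʳ true  false = refl
⟦∧⟧-splitʳ true  true  = refl

⟦∧⟧-splitˡ : ∀ a b → ⟦ (a == true) ∧ b ⟧ + ⟦ (a == false) ∧ b ⟧ ≡ ⟦ b ⟧
⟦∧⟧-splitˡ false b     = refl
⟦∧⟧-splitˡ true  false = refl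
⟦∧⟧-splitˡ true  true  = refl

⟦∧⟧-flip : ∀ a b y → ⟦ a ∧ (b == y) ⟧ + ⟦ a ∧ ((b xor true) == y) ⟧ ≡ ⟦ a ⟧
⟦∧⟧-flip false b     y     = refl
⟦∧⟧-flip true  false false = refl
⟦∧⟧-flip true  false true  = refl
⟦∧⟧-flip true  true  false = refl
⟦∧⟧-flip true  true  true  = refl

-- In use, f and g indicate disjoint events of n/4 rows each and h their union: an entry of one
-- column, or the xor of two columns.
∑*4≡n⇒∑*2≡n : (f g h : Fin n → ℕ) → (∀ j → f j + g j ≡ h j) → sum f * 4 ≡ n → sum g * 4 ≡ n → sum h * 2 ≡ n
∑*4≡n⇒∑*2≡n {n} f g h f+g≗h ef eg = *-cancelˡ-≡ _ _ 2 (begin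
  2 * (sum h * 2)              ≡⟨ cong (λ z → 2 * (z * 2)) (trans (sum-cong-≗ (sym ∘ f+g≗h)) (∑-distrib-+ f g)) ⟩
  2 * ((sum f + sum g) * 2)    ≡⟨ arith (sum f) (sum g) ⟩
  sum f * 4 + sum g * 4        ≡⟨ cong₂ _+_ ef eg ⟩
  n + n                        ≡⟨ cong (n +_) (+-identityʳ n) ⟨
  2 * n                        ∎)
  where
  open ≡-Reasoning
  arith : ∀ a b → 2 * ((a + b) * 2) ≡ a * 4 + b * 4
  arith = solve-∀

-- Sum over the entry in a second column: column 1 if p = 0, column 0 otherwise.
strength1 : {f : Fin n → Bits} → 2 ≤ k → Strength2 k f → ∀ {p} → p < k → ∀ x →
            (∑[ j < n ] ⟦ f j p == x ⟧) * 2 ≡ n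
strength1 {f = f} 2≤k s {zero}  p<k x =
  ∑*4≡n⇒∑*2≡n _ _ _ (λ j → ⟦∧⟧-splitʳ (f j 0 == x) (f j 1)) (s .pairs 2≤k z<s x true) (s .pairs 2≤k z<s x false)
strength1 {f = f} 2≤k s {suc p} p<k x =
  ∑*4≡n⇒∑*2≡n _ _ _ (λ j → ⟦∧⟧-splitˡ (f j 0) (f j (suc p) == x)) (s .pairs p<k z<s true x) (s .pairs p<k z<s false x)

-- Transposition, juxtaposition and tiling

transpose : Design k k M N → Design k k N M
transpose {k} {M} {N} (X , d) = (λ j i → X i j) , record
  { rows    = columns
  ; columns = rows
  ; uniform = record { counts = λ v → trans
      (cong (_* 2 ^ k) (sym (∑-comm λ i j → ⟦ agree k (X i j) v ⟧)))
      (trans (uniform .counts v) (*-comm M N)) }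
  }
  where open IsDesign d

∑∑-++ : (φ : A → ℕ) (X : Fin M → Fin N → A) (Y : Fin M → Fin K → A) →
        sum (λ i → sum (φ ∘ (X i ++ Y i))) ≡ sum (λ i → sum (φ ∘ X i)) + sum (λ i → sum (φ ∘ Y i))
∑∑-++ φ X Y = trans (sum-cong-≗ λ i → sum-++ φ (X i) (Y i)) (∑-distrib-+ (λ i → sum (φ ∘ X i)) _)

columns-++ : (X : Fin M → Fin N → A) (Y : Fin M → Fin n → A) (P : (Fin M → A) → Set) →
             (∀ j → P (λ i → X i j)) → (∀ j → P (λ i → Y i j)) →
             ∀ j → P (λ i → (X i ++ Y i) j)
columns-++ {N = N} X Y P pX pY j with splitAt N j
... | inj₁ j′ = pX j′
... | inj₂ j′ = pY j′

uniform-++ : ∀ {N′} {X : Fin M → Fin N → Bits} {Y : Fin M → Fin N′ → Bits} →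
             Uniform k X → Uniform k Y → Uniform k (λ i → X i ++ Y i)
uniform-++ {M} {N} {k} {N′} {X} {Y} uX uY .counts v = begin
  sum (λ i → sum (φ ∘ (X i ++ Y i))) * 2 ^ k                             ≡⟨ cong (_* 2 ^ k) (∑∑-++ φ X Y) ⟩
  (sum (λ i → sum (φ ∘ X i)) + sum (λ i → sum (φ ∘ Y i))) * 2 ^ k        ≡⟨ *-distribʳ-+ (2 ^ k) (sum λ i → sum (φ ∘ X i)) _ ⟩
  sum (λ i → sum (φ ∘ X i)) * 2 ^ k + sum (λ i → sum (φ ∘ Y i)) * 2 ^ k  ≡⟨ cong₂ _+_ (uX .counts v) (uY .counts v) ⟩
  M * N + M * N′                                                         ≡⟨ *-distribˡ-+ M N N′ ⟨
  M * (N + N′)                                                           ∎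
  where
  open ≡-Reasoning
  φ : Bits → ℕ
  φ w = ⟦ agree k w v ⟧

infixr 5 _∥_
_∥_ : ∀ {N′} → Design k K M N → Design k K M N′ → Design k K M (N + N′)
_∥_ {K = K} (X , d) (Y , e) = (λ i → X i ++ Y i) , record
  { rows    = λ i → strength2-++ (D.rows i) (E.rows i)
  ; columns = columns-++ X Y (Strength2 K) D.columns E.columns
  ; uniform = uniform-++ D.uniform E.uniform
  }
  where
  module D = IsDesign d
  module E = IsDesign e

stack : ∀ {M′} → Design k k M N → Design k k M′ N → Design k k (M + M′) N
stack d e = transpose (transpose d ∥ transpose e)

empty : Design k K M 0
empty {k} {K} {M} = (λ _ ()) , record
  { rows    = λ _ → record { pairs = λ _ _ _ _ → refl }
  ; columns = λ ()
  ; uniform = record { counts = λ _ → trans (cong (_* 2 ^ k) (sum-replicate-zero M)) (sym (*-zeroʳ M)) }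
  }

copies : n ∣ N → Design k K M n → Design k K M N
copies (divides q refl) d = repeat q
  where
  repeat : ∀ q → Design _ _ _ (q * _)
  repeat zero    = empty
  repeat (suc q) = d ∥ repeat q

-- 4 (2 + c) is a sum of 8's and 12's.
tile : Design k K M 8 → Design k K M 12 → ∀ c → Design k K M (4 * (2 + c))
tile d₈ d₁₂ zero          = d₈
tile d₈ d₁₂ (suc zero)    = d₁₂
tile d₈ d₁₂ (suc (suc c)) = subst (Design _ _ _) (sym (*-distribˡ-+ 4 2 (2 + c))) (d₈ ∥ tile d₈ d₁₂ c)

-- Truncation to fewer coordinates

_[_↦_] : Bits → ℕ → Bool → Bits
(v [ k ↦ b ]) c = if c ≡ᵇ k then b else v c

≡ᵇ-refl : ∀ n → (n ≡ᵇ n) ≡ true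
≡ᵇ-refl zero    = refl
≡ᵇ-refl (suc n) = ≡ᵇ-refl n

<⇒≢ᵇ : ∀ {m n} → m < n → (m ≡ᵇ n) ≡ false
<⇒≢ᵇ z<s                = refl
<⇒≢ᵇ (s<s m<n@(s≤s _)) = <⇒≢ᵇ m<n

agree-update : ∀ k w v b → agree (suc k) w (v [ k ↦ b ]) ≡ (w k == b) ∧ agree k w v
agree-update k w v b = cong₂ _∧_
  (cong (λ z → w k == (if z then b else v k)) (≡ᵇ-refl k))
  (agree-cong k (λ _ → refl) λ {c} c<k → cong (if_then b else v c) (<⇒≢ᵇ c<k))

-- A word on k coordinates has two continuations at coordinate k. Their counts add up to its own,
-- and a factor 2 cancels.
uniform-suc⁻¹ : {X : Fin M → Fin N → Bits} → Uniform (suc k) X → Uniform k X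
uniform-suc⁻¹ {M} {N} {k} {X} u .counts v = *-cancelˡ-≡ _ _ 2 (begin
  2 * (S₀ * 2 ^ k)                        ≡⟨ cong (λ z → 2 * (z * 2 ^ k)) split ⟩
  2 * ((S true + S false) * 2 ^ k)        ≡⟨ arith (S true) (S false) (2 ^ k) ⟩
  S true * 2 ^ suc k + S false * 2 ^ suc k  ≡⟨ cong₂ _+_ (u .counts (v [ k ↦ true ])) (u .counts (v [ k ↦ false ])) ⟩
  M * N + M * N                           ≡⟨ cong (M * N +_) (+-identityʳ (M * N)) ⟨
  2 * (M * N)                             ∎)
  where
  open ≡-Reasoning
  S₀ = ∑[ i < M ] ∑[ j < N ] ⟦ agree k (X i j) v ⟧
  s : Bool → Fin M → Fin N → ℕ
  s b i j = ⟦ agree (suc k) (X i j) (v [ k ↦ b ]) ⟧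
  S : Bool → ℕ
  S b = ∑[ i < M ] ∑[ j < N ] s b i j
  cell : ∀ i j → ⟦ agree k (X i j) v ⟧ ≡ s true i j + s false i j
  cell i j = sym (trans
    (cong₂ (λ a b → ⟦ a ⟧ + ⟦ b ⟧) (agree-update k (X i j) v true) (agree-update k (X i j) v false))
    (⟦∧⟧-splitˡ (X i j k) _))
  split : S₀ ≡ S true + S false
  split = trans
    (sum-cong-≗ λ i → trans (sum-cong-≗ (cell i)) (∑-distrib-+ (s true i) (s false i)))
    (∑-distrib-+ (λ i → sum (s true i)) _)
  arith : ∀ a b p → 2 * ((a + b) * p) ≡ a * (2 * p) + b * (2 * p)
  arith = solve-∀

uniform-≤ : {X : Fin M → Fin N → Bits} → k′ ≤′ k → Uniform k X → Uniform k′ X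
uniform-≤ ≤′-refl u = u
uniform-≤ (≤′-step k′≤k) u = uniform-≤ k′≤k (uniform-suc⁻¹ u)

restrict : ∀ {K′} → k′ ≤ k → K′ ≤ K → Design k K M N → Design k′ K′ M N
restrict k′≤k K′≤K (X , d) = X , record
  { rows    = λ i → strength2-≤ k′≤k (rows i)
  ; columns = λ j → strength2-≤ K′≤K (columns j)
  ; uniform = uniform-≤ (≤⇒≤′ k′≤k) uniform
  }
  where open IsDesign d

-- Doubling

flip : ℕ → Bits
flip k c = c ≡ᵇ k

module _ (k : ℕ) (w : Bits) where

  flip-at : (w ⊕ flip k) k ≡ w k xor true
  flip-at = cong (w k xor_) (≡ᵇ-refl k)

  flip-below : ∀ {c} → c < k → (w ⊕ flip k) c ≡ w c
  flip-below {c} c<k = trans (cong (w c xor_) (<⇒≢ᵇ c<k)) (xor-comm (w c) false)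

-- Below coordinate k both halves have strength 2, one being a translate of the other. For a pair (p
-- , k), exactly one of a row and its flipped copy has entry y at k, so the count reduces to that of
-- x in column p alone.
strength2-flip : {f : Fin n → Bits} → 2 ≤ k → Strength2 k f →
                 Strength2 (suc k) (f ++ λ j → f j ⊕ flip k)
strength2-flip {n} {k} {f} 2≤k s .pairs {q} (s≤s q≤k) {p} p<q x y with m≤n⇒m<n∨m≡n q≤k
... | inj₁ q<k  = strength2-++ s (strength2-⊕ (flip k) s) .pairs q<k p<q x y
... | inj₂ refl = begin
  sum (φ ∘ (f ++ f′)) * 4                  ≡⟨ cong (_* 4) (sum-++ φ f f′) ⟩
  (sum (φ ∘ f) + sum (φ ∘ f′)) * 4         ≡⟨ cong (_* 4) (∑-distrib-+ (φ ∘ f) (φ ∘ f′)) ⟨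
  sum (λ j → φ (f j) + φ (f′ j)) * 4       ≡⟨ cong (_* 4) (sum-cong-≗ merge) ⟩
  sum (λ j → ⟦ f j p == x ⟧) * 4           ≡⟨ *-assoc (sum λ j → ⟦ f j p == x ⟧) 2 2 ⟨
  sum (λ j → ⟦ f j p == x ⟧) * 2 * 2       ≡⟨ cong (_* 2) (strength1 2≤k s p<q x) ⟩
  n * 2                                    ≡⟨ *-comm n 2 ⟩
  n + (n + 0)                              ≡⟨ cong (n +_) (+-identityʳ n) ⟩
  n + n                                    ∎
  where
  open ≡-Reasoning
  f′ = λ j → f j ⊕ flip k
  φ : Bits → ℕ
  φ w = ⟦ (w p == x) ∧ (w k == y) ⟧
  merge : ∀ j → φ (f j) + φ (f′ j) ≡ ⟦ f j p == x ⟧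
  merge j = trans
    (cong (φ (f j) +_) (cong₂ (λ a b → ⟦ (a == x) ∧ (b == y) ⟧) (flip-below k (f j) p<q) (flip-at k (f j))))
    (⟦∧⟧-flip (f j p == x) (f j k) y)

-- Of a word and its flipped copy exactly one agrees with v at coordinate k, and below k they
-- coincide. So the sum is unchanged while both 2ᵏ and the number of cells double.
uniform-flip : {X : Fin M → Fin N → Bits} → Uniform k X →
               Uniform (suc k) (λ i → X i ++ λ j → X i j ⊕ flip k)
uniform-flip {M} {N} {k} {X} u .counts v = begin
  sum (λ i → sum (φ ∘ (X i ++ X′ i))) * (2 * 2 ^ k)             ≡⟨ cong (_* (2 * 2 ^ k)) merge ⟩
  S * (2 * 2 ^ k)                                               ≡⟨ arith S (2 ^ k) ⟩
  S * 2 ^ k + S * 2 ^ k                                         ≡⟨ cong (λ z → z + z) (u .counts v) ⟩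
  M * N + M * N                                                 ≡⟨ *-distribˡ-+ M N N ⟨
  M * (N + N)                                                   ∎
  where
  open ≡-Reasoning
  X′ = λ i j → X i j ⊕ flip k
  φ : Bits → ℕ
  φ w = ⟦ agree (suc k) w v ⟧
  S = ∑[ i < M ] ∑[ j < N ] ⟦ agree k (X i j) v ⟧
  ∧-comm-⟦⟧ : ∀ a b → ⟦ a ∧ b ⟧ ≡ ⟦ b ∧ a ⟧
  ∧-comm-⟦⟧ false false = refl
  ∧-comm-⟦⟧ false true  = refl
  ∧-comm-⟦⟧ true  false = refl
  ∧-comm-⟦⟧ true  true  = refl
  cell : ∀ w → φ w + φ (w ⊕ flip k) ≡ ⟦ agree k w v ⟧
  cell w = trans
    (cong₂ _+_ (∧-comm-⟦⟧ (w k == v k) _)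
      (trans (cong₂ (λ a b → ⟦ (a == v k) ∧ b ⟧) (flip-at k w) (agree-cong k (flip-below k w) λ _ → refl))
             (∧-comm-⟦⟧ ((w k xor true) == v k) (agree k w v))))
    (⟦∧⟧-flip (agree k w v) (w k) (v k))
  merge : sum (λ i → sum (φ ∘ (X i ++ X′ i))) ≡ S
  merge = sum-cong-≗ λ i → trans (sum-++ φ (X i) (X′ i))
    (trans (sym (∑-distrib-+ (φ ∘ X i) (φ ∘ X′ i))) (sum-cong-≗ (cell ∘ X i)))
  arith : ∀ a p → a * (2 * p) ≡ a * p + a * p
  arith = solve-∀

-- The new columns are translates of old ones, hence keep strength K, not merely k + 1; this is what
-- lets the step be repeated.
double : 2 ≤ k → Design k K M N → Design (suc k) K M (N + N)
double {k} {K} 2≤k (X , d) = (λ i → X i ++ λ j → X i j ⊕ flip k) , record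
  { rows    = λ i → strength2-flip 2≤k (rows i)
  ; columns = columns-++ X _ (Strength2 K) columns (λ j → strength2-⊕ (flip k) (columns j))
  ; uniform = uniform-flip uniform
  }
  where open IsDesign d

-- K stays fixed throughout the doublings and is cut down to d + k at the end.
extend : ∀ d → 2 ≤ k → d + k ≤ K → Design k K M N → Design (d + k) (d + k) M (2 ^ d * N)
extend {k} {K} {M} {N} d 2≤k d+k≤K D = restrict ≤-refl d+k≤K (go d)
  where
  go : ∀ d → Design (d + k) K M (2 ^ d * N)
  go zero    = subst (Design k K M) (sym (+-identityʳ N)) D
  go (suc d) = subst (Design _ K M) (arith (2 ^ d) N) (double (≤-trans 2≤k (m≤n+m k d)) (go d))
    where
    arith : ∀ p n → p * n + p * n ≡ 2 * p * n
    arith = solve-∀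

-- Checking uniformity and strength by computation

cells : (Fin M → Fin N → Bits) → List Bits
cells X = List.concat (List.tabulate λ i → List.tabulate (X i))

agreeing : ℕ → Bits → List Bits → ℕ
agreeing k v = ListAction.sum ∘ List.map (λ w → ⟦ agree k w v ⟧)

agreeing-++ : ∀ k v ws ws′ → agreeing k v (ws List.++ ws′) ≡ agreeing k v ws + agreeing k v ws′
agreeing-++ k v ws ws′ = trans (cong ListAction.sum (List.map-++ _ ws ws′)) (ListAction.sum-++ (List.map _ ws) _)

agreeing-tabulate : ∀ k v (f : Fin n → Bits) → agreeing k v (List.tabulate f) ≡ ∑[ j < n ] ⟦ agree k (f j) v ⟧
agreeing-tabulate {zero}  k v f = refl
agreeing-tabulate {suc n} k v f = cong (⟦ agree k (f zero) v ⟧ +_) (agreeing-tabulate k v (f ∘ suc))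

agreeing-cells : ∀ k v (X : Fin M → Fin N → Bits) →
                 agreeing k v (cells X) ≡ ∑[ i < M ] ∑[ j < N ] ⟦ agree k (X i j) v ⟧
agreeing-cells {zero}  k v X = refl
agreeing-cells {suc M} k v X = trans
  (agreeing-++ k v (List.tabulate (X zero)) _)
  (cong₂ _+_ (agreeing-tabulate k v (X zero)) (agreeing-cells k v (X ∘ suc)))

having : ℕ → Bool → List Bits → List Bits
having k b = List.filterᵇ λ w → w k == b

-- Bucketing by one coordinate at a time reads each word only k times,
-- instead of comparing it with all 2ᵏ targets.
equidistributed : ℕ → ℕ → List Bits → Bool
equidistributed zero    l ws = List.length ws ≡ᵇ l
equidistributed (suc k) l ws = equidistributed k l (having k true ws) ∧ equidistributed k l (having k false ws)

agreeing-zero : ∀ v ws → agreeing 0 v ws ≡ List.length ws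
agreeing-zero v []       = refl
agreeing-zero v (w ∷ ws) = cong suc (agreeing-zero v ws)

agreeing-suc : ∀ k v ws → agreeing (suc k) v ws ≡ agreeing k v (having k (v k) ws)
agreeing-suc k v []       = refl
agreeing-suc k v (w ∷ ws) with w k == v k
... | true  = cong (⟦ agree k w v ⟧ +_) (agreeing-suc k v ws)
... | false = agreeing-suc k v ws

-- The coordinates of v select one bucket at each level, and the check covers every final bucket.
equidistributed-sound : ∀ k l ws → T (equidistributed k l ws) → ∀ v → agreeing k v ws ≡ l
equidistributed-sound zero    l ws e v = trans (agreeing-zero v ws) (≡ᵇ⇒≡ (List.length ws) l e)
equidistributed-sound (suc k) l ws e v =
  trans (agreeing-suc k v ws) (half (v k))
  where
  both = Equivalence.to T-∧ e
  half : ∀ b → agreeing k v (having k b ws) ≡ l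
  half true  = equidistributed-sound k l _ (proj₁ both) v
  half false = equidistributed-sound k l _ (proj₂ both) v

uniform-by-computation : ∀ k l (X : Fin M → Fin N → Bits) → l * 2 ^ k ≡ M * N →
                         T (equidistributed k l (cells X)) → Uniform k X
uniform-by-computation k l X l*2^k e .counts v =
  trans (cong (_* 2 ^ k) (trans (sym (agreeing-cells k v X)) (equidistributed-sound k l (cells X) e v))) l*2^k

∀Bool? : {P : Pred Bool 0ℓ} → Unary.Decidable P → Dec (∀ b → P b)
∀Bool? P? = map′ (λ { (t , f) true → t ; (t , f) false → f }) (λ p → p true , p false) (P? true ×-dec P? false)

strength2? : ∀ k (f : Fin n → Bits) → Dec (Strength2 k f)
strength2? {n} k f = map′ intro elim (allUpTo? (λ q → allUpTo? (λ p → ∀Bool? λ x → ∀Bool? λ y → _ ≟ n) q) k)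
  where
  Pairs : Set
  Pairs = ∀ {q} → q < k → ∀ {p} → p < q → ∀ x y →
          (∑[ j < n ] ⟦ (f j p == x) ∧ (f j q == y) ⟧) * 4 ≡ n
  intro : Pairs → Strength2 k f
  intro s .pairs q<k = s q<k
  elim : Strength2 k f → Pairs
  elim s q<k = s .pairs q<k

strength2-cong : {f g : Fin n → Bits} → (∀ j c → f j c ≡ g j c) → Strength2 k f → Strength2 k g
strength2-cong f≗g s .pairs {q} q<k {p} p<q x y = trans
  (cong (_* 4) (sum-cong-≗ λ j → cong₂ (λ a b → ⟦ (a == x) ∧ (b == y) ⟧) (sym (f≗g j p)) (sym (f≗g j q))))
  (s .pairs q<k p<q x y)

-- Rows are translates of g and columns are translates of f, so strength is inherited and only
-- uniformity remains to be computed over all cells.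
superpose : ∀ l (f : Fin M → Bits) (g : Fin N → Bits) → l * 2 ^ k ≡ M * N →
            Strength2 K f → Strength2 k g → T (equidistributed k l (cells λ i j → f i ⊕ g j)) →
            Design k K M N
superpose l f g l*2^k sf sg e = (λ i j → f i ⊕ g j) , record
  { rows    = λ i → strength2-cong (λ j c → xor-comm (g j c) (f i c)) (strength2-⊕ (f i) sg)
  ; columns = λ j → strength2-⊕ (g j) sf
  ; uniform = uniform-by-computation _ l _ l*2^k e
  }

-- Small arrays

digits : ℕ → Bits
digits n zero    = n % 2 ≡ᵇ 1
digits n (suc c) = digits (n / 2) c

-- Bit l of i is the coefficient of the l-th generator.
combination : List ℕ → ℕ → Bits
combination []       i = λ _ → false
combination (g ∷ gs) i = (if i % 2 ≡ᵇ 1 then digits g else λ _ → false) ⊕ combination gs (i / 2)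

-- All words of a linear code. Strength 2 means that the columns of the generator matrix are nonzero
-- and distinct.
linear : (gs : List ℕ) → Fin (2 ^ List.length gs) → Bits
linear gs = combination gs ∘ toℕ

design-2-4-4 : Design 2 3 4 4
design-2-4-4 = superpose 4 simplex simplex refl
  (toWitness {a? = strength2? 3 simplex} _) (toWitness {a? = strength2? 2 simplex} _) _
  -- The even-weight code of length 3. Its words run through 𝔽₂² on coordinates 0 and 1, so each sum
  -- arises 4 times.
  where simplex = linear (5 ∷ 6 ∷ [])

design-6-8-8 : Design 6 7 8 8
design-6-8-8 = superpose 1 f g refl
  (toWitness {a? = strength2? 7 f} _) (toWitness {a? = strength2? 6 g} _) _
  where
  -- The simplex code of length 7: column c of the generators is c + 1 in binary. Cut to 6
  -- coordinates, it is a complement of g in 𝔽₂⁶, so every word is a sum in one way.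
  f = linear (85 ∷ 102 ∷ 120 ∷ [])
  g = linear (41 ∷ 58 ∷ 52 ∷ [])

design-7-16-8 : Design 7 15 16 8
design-7-16-8 = superpose 1 f g refl
  (toWitness {a? = strength2? 15 f} _) (toWitness {a? = strength2? 7 g} _) _
  where
  -- The simplex code of length 15: column c of the generators is 15 - c in binary. Cut to 7
  -- coordinates, it is a complement of g, the simplex code of length 7.
  f = linear (21845 ∷ 13107 ∷ 3855 ∷ 255 ∷ [])
  g = linear (101 ∷ 54 ∷ 120 ∷ [])

-- Bit c of 324877 is 0 exactly when c is a nonzero square modulo 19.
paley : Fin 20 → Bits
paley zero    c = false
paley (suc i) c = digits 324877 ((c + toℕ i) % 19)

-- The code g is the dual of {0, u, v, u + v} for u and v supported on coordinates
-- 0–4 and {0, 2, 5, 6, 7}. These words have weight at least 5, so g has strength 2,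
-- and their characters sum to 0 over the rows of paley, whence uniformity.
design-8-20-64 : Design 8 19 20 64
design-8-20-64 = superpose 5 paley g refl
  (toWitness {a? = strength2? 19 paley} _) (toWitness {a? = strength2? 8 g} _) _
  where
  g = linear (5 ∷ 10 ∷ 18 ∷ 35 ∷ 67 ∷ 131 ∷ [])

tabulated : ∀ l (t : Vec (Vec ℕ N) M) → let X = λ i → digits ∘ lookup (lookup t i) in
            l * 2 ^ k ≡ M * N → True (Fin.all? λ i → strength2? k (X i)) →
            True (Fin.all? λ j → strength2? K λ i → X i j) → T (equidistributed k l (cells X)) →
            Design k K M N
tabulated l t l*2^k r c e = _ , record
  { rows    = toWitness r
  ; columns = toWitness c
  ; uniform = uniform-by-computation _ l _ l*2^k e
  }

-- Found by computer among the arrays whose bit c in row (a , r) and column (b , s)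
-- is χ_c(a) + x_c(a + b , s − r), where a, b ∈ (ℤ/2)², r, s ∈ ℤ/3 and each χ_c is a
-- character: row and column sums then need checking in one row and column only.
design-4-12-12 : Design 4 4 12 12
design-4-12-12 = tabulated 9 table refl _ _ _
  where
  table : Vec (Vec ℕ 12) 12
  table =
    ( 5 ∷  5 ∷  2 ∷ 15 ∷  9 ∷ 12 ∷ 11 ∷ 14 ∷  8 ∷  3 ∷  6 ∷  0 ∷ []) ∷
    ( 2 ∷  5 ∷  5 ∷ 12 ∷ 15 ∷  9 ∷  8 ∷ 11 ∷ 14 ∷  0 ∷  3 ∷  6 ∷ []) ∷
    ( 5 ∷  2 ∷  5 ∷  9 ∷ 12 ∷ 15 ∷ 14 ∷  8 ∷ 11 ∷  6 ∷  0 ∷  3 ∷ []) ∷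
    ( 8 ∷ 14 ∷ 11 ∷  2 ∷  2 ∷  5 ∷  4 ∷  1 ∷  7 ∷ 12 ∷  9 ∷ 15 ∷ []) ∷
    (11 ∷  8 ∷ 14 ∷  5 ∷  2 ∷  2 ∷  7 ∷  4 ∷  1 ∷ 15 ∷ 12 ∷  9 ∷ []) ∷
    (14 ∷ 11 ∷  8 ∷  2 ∷  5 ∷  2 ∷  1 ∷  7 ∷  4 ∷  9 ∷ 15 ∷ 12 ∷ []) ∷
    ( 3 ∷  6 ∷  0 ∷ 11 ∷ 14 ∷  8 ∷ 13 ∷ 13 ∷ 10 ∷  7 ∷  1 ∷  4 ∷ []) ∷
    ( 0 ∷  3 ∷  6 ∷  8 ∷ 11 ∷ 14 ∷ 10 ∷ 13 ∷ 13 ∷  4 ∷  7 ∷  1 ∷ []) ∷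
    ( 6 ∷  0 ∷  3 ∷ 14 ∷  8 ∷ 11 ∷ 13 ∷ 10 ∷ 13 ∷  1 ∷  4 ∷  7 ∷ []) ∷
    (12 ∷  9 ∷ 15 ∷  4 ∷  1 ∷  7 ∷  0 ∷  6 ∷  3 ∷ 10 ∷ 10 ∷ 13 ∷ []) ∷
    (15 ∷ 12 ∷  9 ∷  7 ∷  4 ∷  1 ∷  3 ∷  0 ∷  6 ∷ 13 ∷ 10 ∷ 10 ∷ []) ∷
    ( 9 ∷ 15 ∷ 12 ∷  1 ∷  7 ∷  4 ∷  6 ∷  3 ∷  0 ∷ 10 ∷ 13 ∷ 10 ∷ []) ∷ []

-- Bits 0 to 4 come from a similar search, with x_c(a + b , r , s) for r ∈ ℤ/3 and
-- s ∈ ℤ/2; bits 5 to 10 complete each column to an OA(12, 11, 2, 2).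
design-5-12-8 : Design 5 11 12 8
design-5-12-8 = tabulated 3 table refl _ _ _
  where
  table : Vec (Vec ℕ 8) 12
  table =
    (  25 ∷   15 ∷    4 ∷   23 ∷   18 ∷   10 ∷    1 ∷   28 ∷ []) ∷
    ( 406 ∷ 1253 ∷ 1624 ∷ 1134 ∷ 1472 ∷ 1309 ∷  939 ∷  179 ∷ []) ∷
    ( 757 ∷  510 ∷ 2020 ∷  975 ∷ 1720 ∷  467 ∷ 1378 ∷  617 ∷ []) ∷
    (1187 ∷  144 ∷  382 ∷  136 ∷  934 ∷ 1723 ∷ 1845 ∷ 1453 ∷ []) ∷
    (1407 ∷  969 ∷  465 ∷  802 ∷  588 ∷  180 ∷ 1735 ∷ 1402 ∷ []) ∷
    ( 835 ∷ 1320 ∷ 1202 ∷  633 ∷ 1061 ∷ 1518 ∷  127 ∷ 1780 ∷ []) ∷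
    (1754 ∷  610 ∷ 1321 ∷  500 ∷  881 ∷  807 ∷ 1196 ∷  991 ∷ []) ∷
    ( 488 ∷  821 ∷  611 ∷ 1467 ∷ 1406 ∷  717 ∷  752 ∷  806 ∷ []) ∷
    (1840 ∷ 1723 ∷  906 ∷ 1345 ∷  413 ∷ 1622 ∷  844 ∷ 1095 ∷ []) ∷
    ( 558 ∷ 1363 ∷  701 ∷ 1701 ∷  235 ∷  888 ∷  406 ∷  448 ∷ []) ∷
    (1092 ∷ 1628 ∷ 1231 ∷ 1746 ∷ 1751 ∷ 1121 ∷ 1497 ∷ 1674 ∷ []) ∷
    (1933 ∷ 1926 ∷ 1815 ∷ 1820 ∷ 1803 ∷ 1920 ∷ 1562 ∷ 1809 ∷ []) ∷ []

-- Translation to and from `IsOA` and `TypeI`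

count-tabulate : {P : Pred A 0ℓ} (P? : Unary.Decidable P) (f : Fin n → A) →
                 count P? (tabulate f) ≡ ∑[ j < n ] ⟦ does (P? (f j)) ⟧
count-tabulate {n = zero}  P? f = refl
count-tabulate {n = suc n} P? f with does (P? (f zero))
... | true  = cong suc (count-tabulate P? (f ∘ suc))
... | false = count-tabulate P? (f ∘ suc)

count-++ : {P : Pred A 0ℓ} (P? : Unary.Decidable P) (xs : Vec A M) (ys : Vec A N) →
           count P? (xs Vec.++ ys) ≡ count P? xs + count P? ys
count-++ P? []       ys = refl
count-++ P? (x ∷ xs) ys with does (P? x)
... | true  = cong suc (count-++ P? xs ys)
... | false = count-++ P? xs ys

count-concat : {P : Pred A 0ℓ} (P? : Unary.Decidable P) (X : Fin M → Fin N → A) →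
               count P? (concat (tabulate λ i → tabulate (X i))) ≡ ∑[ i < M ] ∑[ j < N ] ⟦ does (P? (X i j)) ⟧
count-concat {M = zero}  P? X = refl
count-concat {M = suc M} P? X = trans
  (count-++ P? (tabulate (X zero)) _)
  (cong₂ _+_ (count-tabulate P? (X zero)) (count-concat P? (X ∘ suc)))

word : ∀ k → Bits → Word 2 k
word k w = tabulate (level ∘ w ∘ toℕ)

bits : Word 2 k → Bits
bits []      c       = false
bits (x ∷ v) zero    = bit x
bits (x ∷ v) (suc c) = bits v c

bits-toℕ : (v : Word 2 k) (i : Fin k) → bits v (toℕ i) ≡ bit (lookup v i)
bits-toℕ (x ∷ v) zero    = refl
bits-toℕ (x ∷ v) (suc i) = bits-toℕ v i

bits-fromℕ< : (v : Word 2 k) {c : ℕ} (c<k : c < k) → bits v c ≡ bit (lookup v (fromℕ< c<k))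
bits-fromℕ< v c<k = trans (cong (bits v) (sym (toℕ-fromℕ< c<k))) (bits-toℕ v (fromℕ< c<k))

bit-lookup-word : ∀ w (i : Fin k) → bit (lookup (word k w) i) ≡ w (toℕ i)
bit-lookup-word w i = trans (cong bit (lookup∘tabulate _ i)) (bit-level (w (toℕ i)))

bits-word : ∀ w {c} → c < k → bits (word k w) c ≡ w c
bits-word w c<k = trans (bits-fromℕ< (word _ w) c<k)
  (trans (bit-lookup-word w (fromℕ< c<k)) (cong w (toℕ-fromℕ< c<k)))

word-bits : (v : Word 2 k) → word k (bits v) ≡ v
word-bits v = trans
  (tabulate-cong λ i → trans (cong level (bits-toℕ v i)) (level-bit (lookup v i)))
  (tabulate∘lookup v)

==-refl : ∀ x → (x == x) ≡ true
==-refl x = cong not (xor-same x)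

==⇒≡ : ∀ x y → (x == y) ≡ true → x ≡ y
==⇒≡ false false _ = refl
==⇒≡ true  true  _ = refl

agree-refl : ∀ k w → agree k w w ≡ true
agree-refl zero    w = refl
agree-refl (suc k) w = cong₂ _∧_ (==-refl (w k)) (agree-refl k w)

agree⇒≡ : ∀ k {w v} → agree k w v ≡ true → ∀ {c} → c < k → w c ≡ v c
agree⇒≡ (suc k) a (s≤s c≤k) with m≤n⇒m<n∨m≡n c≤k
... | inj₁ c<k  = agree⇒≡ k (∧-conicalʳ _ _ a) c<k
... | inj₂ refl = ==⇒≡ _ _ (∧-conicalˡ _ _ a)

does-≟ʷ : ∀ w (v : Word 2 k) → does (word k w ≟ʷ v) ≡ agree k w (bits v)
does-≟ʷ {k} w v with agree k w (bits v) in eq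
... | true  = dec-true (word k w ≟ʷ v) (trans
  (tabulate-cong λ i → cong level (agree⇒≡ k eq (toℕ<n i)))
  (word-bits v))
... | false = dec-false (word k w ≟ʷ v) λ { refl → contradiction
  (trans (sym eq) (trans (agree-cong k (λ c<k → sym (bits-word w c<k)) λ _ → refl) (agree-refl k _)))
  λ () }

does-≟ : ∀ (a b : Fin 2) → does (a Fin.≟ b) ≡ (bit a == bit b)
does-≟ zero       zero       = refl
does-≟ zero       (suc zero) = refl
does-≟ (suc zero) zero       = refl
does-≟ (suc zero) (suc zero) = refl

does-≟ʷ₂ : ∀ (a b c d : Fin 2) →
           does ((a ∷ b ∷ []) ≟ʷ (c ∷ d ∷ [])) ≡ (bit a == bit c) ∧ (bit b == bit d)
does-≟ʷ₂ a b c d = cong₂ _∧_ (does-≟ a c) (trans (∧-identityʳ _) (does-≟ b d))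

strength2⇒isOA : {f : Fin n → Bits} → 2 ≤ k → Strength2 k f → IsOA n k 2 2 (word k ∘ f)
strength2⇒isOA {k = k} {f} 2≤k s = record
  { 1≤t      = s≤s z≤n
  ; t≤k      = 2≤k
  ; balanced = λ { c c-mono v@(x ∷ y ∷ []) → trans
      (cong (_* 4) (trans (count-tabulate (_≟ʷ v) (select c ∘ word k ∘ f)) (sum-cong-≗ λ j → cong ⟦_⟧ (trans
        (does-≟ʷ₂ (lookup (word k (f j)) (c zero)) (lookup (word k (f j)) (c (suc zero))) x y)
        (cong₂ (λ a b → (a == bit x) ∧ (b == bit y)) (bit-lookup-word (f j) (c zero)) (bit-lookup-word (f j) (c (suc zero))))))))
      (s .pairs (toℕ<n (c (suc zero))) (c-mono {zero} {suc zero} z<s) (bit x) (bit y)) }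
  }

isOA⇒strength2 : {row : Fin n → Word 2 k} → IsOA n k 2 2 row → Strength2 k (bits ∘ row)
isOA⇒strength2 {n} {k} {row} oa .pairs {q} q<k {p} p<q x y = trans
  (cong (_* 4) (sym (trans (count-tabulate (_≟ʷ v) (select c ∘ row)) (sum-cong-≗ λ j → cong ⟦_⟧ (trans
    (does-≟ʷ₂ (lookup (row j) (fromℕ< p<k)) (lookup (row j) (fromℕ< q<k)) (level x) (level y))
    (cong₂ _∧_ (cong₂ _==_ (sym (bits-fromℕ< (row j) p<k)) (bit-level x))
               (cong₂ _==_ (sym (bits-fromℕ< (row j) q<k)) (bit-level y))))))))
  (IsOA.balanced oa c (λ {i} {j} → c-mono {i} {j}) v)
  where
  p<k = <-trans p<q q<k
  v = level x ∷ level y ∷ []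
  c : Fin 2 → Fin k
  c zero       = fromℕ< p<k
  c (suc zero) = fromℕ< q<k
  c-mono : ∀ {i j} → i Fin.< j → c i Fin.< c j
  c-mono {zero}     {suc zero} _ = subst₂ _<_ (sym (toℕ-fromℕ< p<k)) (sym (toℕ-fromℕ< q<k)) p<q
  c-mono {suc zero} {suc zero} (s≤s ())

design⇒typeI : 2 ≤ k → Design k k M N → TypeI k M N 2 2
design⇒typeI {k} 2≤k (X , d) = (λ i j → word k (X i j)) , record
  { uniform = λ v → trans
      (cong (_* 2 ^ k) (trans (count-concat (_≟ʷ v) λ i j → word k (X i j))
                              (sum-cong-≗ λ i → sum-cong-≗ λ j → cong ⟦_⟧ (does-≟ʷ (X i j) v))))
      (uniform .counts (bits v))
  ; rows    = λ i → strength2⇒isOA 2≤k (rows i)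
  ; columns = λ j → strength2⇒isOA 2≤k (columns j)
  }
  where open IsDesign d

-- Rao's bound

sign : Bool → ℤ
sign b = if b then -1ℤ else 1ℤ

sign-xor : ∀ a b → sign a *ᶻ sign b ≡ sign (a xor b)
sign-xor false false = refl
sign-xor false true  = refl
sign-xor true  false = refl
sign-xor true  true  = refl

∑-pos : (f : Fin n → ℕ) → ∑ℤ.sum (pos ∘ f) ≡ pos (sum f)
∑-pos {zero}  f = refl
∑-pos {suc n} f = cong (pos (f zero) +ᶻ_) (∑-pos (f ∘ suc))

∑-const : ∀ n → ∑ℤ.sum {n} (λ _ → 1ℤ) ≡ pos n
∑-const zero    = refl
∑-const (suc n) = cong (1ℤ +ᶻ_) (∑-const n)

-- Each sign is 1 - 2b for its bit b; the subtrahend stands on the left to keep counts in ℕ.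
∑-sign : (s : Fin n → Bool) → ∑ℤ.sum (sign ∘ s) +ᶻ pos (sum (⟦_⟧ ∘ s) * 2) ≡ pos n
∑-sign {n} s = begin
  ∑ℤ.sum (sign ∘ s) +ᶻ pos (sum (⟦_⟧ ∘ s) * 2)                 ≡⟨ cong (λ z → ∑ℤ.sum (sign ∘ s) +ᶻ pos z) (*-distribʳ-sum 2 (⟦_⟧ ∘ s)) ⟩
  ∑ℤ.sum (sign ∘ s) +ᶻ pos (sum λ j → ⟦ s j ⟧ * 2)              ≡⟨ cong (∑ℤ.sum (sign ∘ s) +ᶻ_) (∑-pos λ j → ⟦ s j ⟧ * 2) ⟨
  ∑ℤ.sum (sign ∘ s) +ᶻ ∑ℤ.sum (λ j → pos (⟦ s j ⟧ * 2))        ≡⟨ ∑ℤ.∑-distrib-+ (sign ∘ s) _ ⟨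
  ∑ℤ.sum (λ j → sign (s j) +ᶻ pos (⟦ s j ⟧ * 2))               ≡⟨ ∑ℤ.sum-cong-≗ (one ∘ s) ⟩
  ∑ℤ.sum {n} (λ _ → 1ℤ)                                       ≡⟨ ∑-const n ⟩
  pos n                                                         ∎
  where
  open ≡-Reasoning
  one : ∀ b → sign b +ᶻ pos (⟦ b ⟧ * 2) ≡ 1ℤ
  one false = refl
  one true  = refl

∑-sign≡0 : (s : Fin n → Bool) → sum (⟦_⟧ ∘ s) * 2 ≡ n → ∑ℤ.sum (sign ∘ s) ≡ 0ℤ
∑-sign≡0 s half = identityˡ-unique _ _ (trans (cong (λ z → ∑ℤ.sum (sign ∘ s) +ᶻ pos z) (sym half)) (∑-sign s))

0≤i*i : ∀ i → 0ℤ ≤ᶻ i *ᶻ i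
0≤i*i (pos zero)  = ℤ.+≤+ z≤n
0≤i*i (pos (suc n)) = ℤ.+≤+ z≤n
0≤i*i ℤ.-[1+ n ]  = ℤ.+≤+ z≤n

square≤∑squares : (f : Fin n → ℤ) (j : Fin n) → f j *ᶻ f j ≤ᶻ ∑ℤ.sum (λ i → f i *ᶻ f i)
square≤∑squares {suc n} f zero = ℤ.≤-trans (ℤ.≤-reflexive (sym (ℤ.+-identityʳ _)))
  (ℤ.+-monoʳ-≤ (f zero *ᶻ f zero) (0≤∑ (f ∘ suc)))
  where
  0≤∑ : ∀ {n} (g : Fin n → ℤ) → 0ℤ ≤ᶻ ∑ℤ.sum (λ i → g i *ᶻ g i)
  0≤∑ {zero}  g = ℤ.≤-refl
  0≤∑ {suc n} g = ℤ.+-mono-≤ (0≤i*i (g zero)) (0≤∑ (g ∘ suc))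
square≤∑squares {suc n} f (suc j) = ℤ.≤-trans (ℤ.≤-reflexive (sym (ℤ.+-identityˡ _)))
  (ℤ.+-mono-≤ (0≤i*i (f zero)) (square≤∑squares (f ∘ suc) j))

module _ {f : Fin n → Bits} (2≤k : 2 ≤ k) (s : Strength2 k f) where

  private
    σ : ℕ → Fin n → ℤ
    σ c j = sign (f j c)

    partial : ℕ → Fin n → ℤ
    partial zero    j = 1ℤ
    partial (suc c) j = partial c j +ᶻ σ c j

    ∑σ≡0 : ∀ {c} → c < k → ∑ℤ.sum (σ c) ≡ 0ℤ
    ∑σ≡0 {c} c<k = ∑-sign≡0 (λ j → f j c)
      (trans (cong (_* 2) (sum-cong-≗ λ j → cong ⟦_⟧ (sym (==-true (f j c))))) (strength1 2≤k s c<k true))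
      where
      ==-true : ∀ b → (b == true) ≡ b
      ==-true false = refl
      ==-true true  = refl

    -- The product of two signs is the sign of the xor, which is true on half of the rows: a quarter
    -- for each of the patterns (1 , 0) and (0 , 1).
    ∑σσ≡0 : ∀ {p q} → p < q → q < k → ∑ℤ.sum (λ j → σ p j *ᶻ σ q j) ≡ 0ℤ
    ∑σσ≡0 {p} {q} p<q q<k = trans
      (∑ℤ.sum-cong-≗ λ j → sign-xor (f j p) (f j q))
      (∑-sign≡0 _ (∑*4≡n⇒∑*2≡n _ _ _ (λ j → xor-cases (f j p) (f j q)) (s .pairs q<k p<q true false) (s .pairs q<k p<q false true)))
      where
      xor-cases : ∀ a b → ⟦ (a == true) ∧ (b == false) ⟧ + ⟦ (a == false) ∧ (b == true) ⟧ ≡ ⟦ a xor b ⟧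
      xor-cases false false = refl
      xor-cases false true  = refl
      xor-cases true  false = refl
      xor-cases true  true  = refl

    partial-⊥-σ : ∀ {c d} → c ≤ d → d < k → ∑ℤ.sum (λ j → partial c j *ᶻ σ d j) ≡ 0ℤ
    partial-⊥-σ {zero}  {d} c≤d d<k = trans (∑ℤ.sum-cong-≗ λ j → ℤ.*-identityˡ (σ d j)) (∑σ≡0 d<k)
    partial-⊥-σ {suc c} {d} c<d d<k = trans
      (∑ℤ.sum-cong-≗ λ j → ℤ.*-distribʳ-+ (σ d j) (partial c j) (σ c j))
      (trans (∑ℤ.∑-distrib-+ (λ j → partial c j *ᶻ σ d j) _)
             (cong₂ _+ᶻ_ (partial-⊥-σ (<⇒≤ c<d) d<k) (∑σσ≡0 c<d d<k)))

    -- Pythagoras: `partial c` is a sum of c + 1 pairwise orthogonal vectors of squared norm n.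
    ∑partial² : ∀ {c} → c ≤ k → ∑ℤ.sum (λ j → partial c j *ᶻ partial c j) ≡ pos (n * suc c)
    ∑partial² {zero}  _   = trans (∑-const n) (cong pos (sym (*-identityʳ n)))
    ∑partial² {suc c} c<k = begin
      ∑ℤ.sum (λ j → partial (suc c) j *ᶻ partial (suc c) j)                        ≡⟨ ∑ℤ.sum-cong-≗ expand ⟩
      ∑ℤ.sum (λ j → P j +ᶻ (C j +ᶻ (C j +ᶻ 1ℤ)))                               ≡⟨ ∑ℤ.∑-distrib-+ P _ ⟩
      ∑ℤ.sum P +ᶻ ∑ℤ.sum (λ j → C j +ᶻ (C j +ᶻ 1ℤ))                            ≡⟨ cong (∑ℤ.sum P +ᶻ_) (∑ℤ.∑-distrib-+ C _) ⟩
      ∑ℤ.sum P +ᶻ (∑ℤ.sum C +ᶻ ∑ℤ.sum (λ j → C j +ᶻ 1ℤ))                       ≡⟨ cong (λ z → ∑ℤ.sum P +ᶻ (∑ℤ.sum C +ᶻ z)) (∑ℤ.∑-distrib-+ C _) ⟩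
      ∑ℤ.sum P +ᶻ (∑ℤ.sum C +ᶻ (∑ℤ.sum C +ᶻ ∑ℤ.sum {n} (λ _ → 1ℤ)))            ≡⟨ cong₂ (λ x y → x +ᶻ (y +ᶻ (y +ᶻ ∑ℤ.sum {n} (λ _ → 1ℤ)))) (∑partial² (<⇒≤ c<k)) (partial-⊥-σ ≤-refl c<k) ⟩
      pos (n * suc c) +ᶻ (0ℤ +ᶻ (0ℤ +ᶻ ∑ℤ.sum {n} (λ _ → 1ℤ)))             ≡⟨ cong (pos (n * suc c) +ᶻ_) (trans (ℤ.+-identityˡ _) (trans (ℤ.+-identityˡ _) (∑-const n))) ⟩
      pos (n * suc c + n)                                                           ≡⟨ cong pos (trans (+-comm (n * suc c) n) (sym (*-suc n (suc c)))) ⟩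
      pos (n * suc (suc c))                                                         ∎
      where
      open ≡-Reasoning
      P C : Fin n → ℤ
      P j = partial c j *ᶻ partial c j
      C j = partial c j *ᶻ σ c j
      binomial : ∀ a b → (a +ᶻ b) *ᶻ (a +ᶻ b) ≡ a *ᶻ a +ᶻ (a *ᶻ b +ᶻ (a *ᶻ b +ᶻ b *ᶻ b))
      binomial = ℤ.solve-∀
      sign² : ∀ b → sign b *ᶻ sign b ≡ 1ℤ
      sign² false = refl
      sign² true  = refl
      expand : ∀ j → partial (suc c) j *ᶻ partial (suc c) j ≡ P j +ᶻ (C j +ᶻ (C j +ᶻ 1ℤ))
      expand j = trans (binomial (partial c j) (σ c j))
        (cong (λ z → P j +ᶻ (C j +ᶻ (C j +ᶻ z))) (sign² (f j c)))

    partial-zero-row : ∀ {j} → (∀ c → f j c ≡ false) → ∀ c → partial c j ≡ pos (suc c)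
    partial-zero-row z zero    = refl
    partial-zero-row z (suc c) = trans (cong₂ _+ᶻ_ (partial-zero-row z c) (cong sign (z c))) (cong pos (+-comm (suc c) 1))

  -- At a zero row all signs are 1, so the entry of `partial k` is k + 1, and (k + 1)² ≤ n (k + 1).
  -- Translating by any row of an array produces a zero row.
  zero-row⇒k<n : (j : Fin n) → (∀ c → f j c ≡ false) → k < n
  zero-row⇒k<n j z = *-cancelʳ-≤ (suc k) n (suc k) (ℤ.drop‿+≤+ (subst₂ _≤ᶻ_
    (trans (cong₂ _*ᶻ_ at-j at-j) (sym (ℤ.pos-* (suc k) (suc k))))
    (∑partial² ≤-refl)
    (square≤∑squares (partial k) j)))
    where
    at-j = partial-zero-row z k

-- Rao's bound, by Bessel's inequality: the constant vector and the k columns,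
-- written with entries ±1, are orthogonal in ℤⁿ.
k<n : {f : Fin n → Bits} → 2 ≤ k → Strength2 k f → Fin n → k < n
k<n {f = f} 2≤k s j = zero-row⇒k<n 2≤k (strength2-⊕ (f j) s) j (λ c → xor-same (f j c))

-- Powers of 2

4∣n : {f : Fin n → Bits} → 2 ≤ k → Strength2 k f → 4 ∣ n
4∣n {n} {f = f} 2≤k s =
  divides (∑[ j < n ] ⟦ (f j 0 == true) ∧ (f j 1 == true) ⟧) (sym (s .pairs 2≤k z<s true true))

2^e∣2^a*b : ∀ {e a} b → e ≤ a → 2 ^ e ∣ 2 ^ a * b
2^e∣2^a*b {e} {a} b e≤a = ∣m⇒∣m*n b (subst (λ z → 2 ^ e ∣ 2 ^ z) (m+[n∸m]≡n e≤a)
  (subst (2 ^ e ∣_) (sym (^-distribˡ-+-* 2 e (a ∸ e))) (m∣m*n (2 ^ (a ∸ e)))))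

2^k∣2^a*b⇒k≤a : ∀ {b} → 2 ∤ b → ∀ k a → 2 ^ k ∣ 2 ^ a * b → k ≤ a
2^k∣2^a*b⇒k≤a     2∤b zero    a       _ = z≤n
2^k∣2^a*b⇒k≤a {b} 2∤b (suc k) zero    d =
  contradiction (∣-trans (m∣m*n (2 ^ k)) (subst (2 ^ suc k ∣_) (*-identityˡ b) d)) 2∤b
2^k∣2^a*b⇒k≤a {b} 2∤b (suc k) (suc a) d =
  s≤s (2^k∣2^a*b⇒k≤a 2∤b k a (*-cancelˡ-∣ 2 (subst (2 ^ suc k ∣_) (*-assoc 2 (2 ^ a) b) d)))

-- The height is 4m = 2ʳ (2h + 1). As b is odd, r + a is the exact exponent of 2 in the number of
-- cells.
valuation-bound : ∀ {a b} r h → 2 ∤ b → 2 ^ k ∣ (2 ^ r * suc (h * 2)) * (2 ^ a * b) → k ≤ r + a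
valuation-bound {k} {a} {b} r h 2∤b d = 2^k∣2^a*b⇒k≤a odd k (r + a) (subst (2 ^ k ∣_) regroup d)
  where
  odd : 2 ∤ suc (h * 2) * b
  odd 2∣ = 2∤b (∣m+n∣m⇒∣n (subst (2 ∣_) (+-comm b (h * 2 * b)) 2∣) (∣m⇒∣m*n b (n∣m*n h)))
  arith : ∀ x y z w → (x * y) * (z * w) ≡ (x * z) * (y * w)
  arith = solve-∀
  regroup : (2 ^ r * suc (h * 2)) * (2 ^ a * b) ≡ 2 ^ (r + a) * (suc (h * 2) * b)
  regroup = trans (arith (2 ^ r) (suc (h * 2)) (2 ^ a) b)
                  (cong (_* (suc (h * 2) * b)) (sym (^-distribˡ-+-* 2 r a)))

-- Arrays for each height

at-most : ∀ m n {_ : True (m ≤? n)} → m ≤ n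
at-most m n {m≤n} = toWitness m≤n

design-3-4-8 : Design 3 3 4 8
design-3-4-8 = extend 1 ≤-refl ≤-refl design-2-4-4

design-3-8-4 : Design 3 3 8 4
design-3-8-4 = transpose design-3-4-8

design-5-8-8 : Design 5 7 8 8
design-5-8-8 = restrict (at-most 5 6) ≤-refl design-6-8-8

design-5-8-12 : Design 5 5 8 12
design-5-8-12 = transpose (restrict ≤-refl (at-most 5 11) design-5-12-8)

design-6-16-12 : Design 6 6 16 12
design-6-16-12 = transpose (extend 1 (at-most 2 5) (at-most 6 11) design-5-12-8)

module _ {a b : ℕ} (2≤a : 2 ≤ a) (1≤b : 1 ≤ b) where

  private
    width : ℕ
    width = 2 ^ a * b

    narrow : ∀ e → e ≤ a → k ≤ K → Design K K M (2 ^ e) → Design k k M width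
    narrow e e≤a k≤K d = copies (2^e∣2^a*b b e≤a) (restrict k≤K k≤K d)

    wide : width ≢ 4 → k ≤ K → Design K K M 8 → Design K K M 12 → Design k k M width
    wide {k} {K} {M} ≢4 k≤K d₈ d₁₂ with 2^e∣2^a*b b 2≤a
    -- The width is 4c, and c = 0 contradicts b ≥ 1.
    ... | divides zero          eq = contradiction eq (>⇒≢ (*-mono-≤ (m^n>0 2 a) 1≤b))
    ... | divides (suc zero)    eq = contradiction eq ≢4
    ... | divides (suc (suc c)) eq = subst (Design k k M) (trans (*-comm 4 (2 + c)) (sym eq))
                                       (restrict k≤K k≤K (tile d₈ d₁₂ c))

    -- For large k: d = k - (r + e) doublings reach width 2 ^ (d + e), and k ≤ r + a says precisely
    -- that d + e ≤ a, so copies fill the width.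
    extended : ∀ r e → 2 ≤ r + e → r + e ≤ k → k ≤ K → k ≤ r + a → Design (r + e) K M (2 ^ e) → Design k k M width
    extended {k} {K} {M} r e 2≤k₀ k₀≤k k≤K k≤r+a D =
      copies divisible (subst (λ z → Design z z M (2 ^ d * 2 ^ e)) d+k₀ (extend d 2≤k₀ (subst (_≤ K) (sym d+k₀) k≤K) D))
      where
      d = k ∸ (r + e)
      d+k₀ : d + (r + e) ≡ k
      d+k₀ = m∸n+n≡m k₀≤k
      arith : ∀ d r e → d + (r + e) ≡ r + (d + e)
      arith = solve-∀
      divisible : 2 ^ d * 2 ^ e ∣ width
      divisible = subst (_∣ width) (^-distribˡ-+-* 2 d e) (2^e∣2^a*b b
        (+-cancelˡ-≤ r (d + e) a (subst (_≤ r + a) (trans (sym d+k₀) (arith d r e)) k≤r+a)))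

  design-4 : k ≤ 3 → (2 < k → 3 ≤ a) → Design k k 4 width
  design-4 {k} k≤3 3≤a with k ≤? 2
  ... | yes k≤2 = narrow 2 2≤a k≤2 (restrict ≤-refl (at-most 2 3) design-2-4-4)
  ... | no  k≰2 = narrow 3 (3≤a (≰⇒> k≰2)) k≤3 design-3-4-8

  design-8 : k ≤ 7 → k ≤ 3 + a → (3 < k → width ≢ 4) → Design k k 8 width
  design-8 {k} k≤7 k≤3+a ≢4 with k ≤? 3 | k ≤? 5
  ... | yes k≤3 | _       = narrow 2 2≤a k≤3 design-3-8-4
  ... | no  k≰3 | yes k≤5 = wide (≢4 (≰⇒> k≰3)) k≤5 (restrict ≤-refl (at-most 5 7) design-5-8-8) design-5-8-12
  ... | _       | no  k≰5 = extended 3 3 (at-most 2 6) (≰⇒> k≰5) k≤7 k≤3+a design-6-8-8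

  design-12 : k ≤ 11 → k ≤ 2 + a → (2 < k → width ≢ 4) → Design k k 12 width
  design-12 {k} k≤11 k≤2+a ≢4 with k ≤? 2 | k ≤? 4
  ... | yes k≤2 | _       = narrow 2 2≤a k≤2 (transpose (copies (divides 3 refl) (restrict ≤-refl (at-most 2 3) design-2-4-4)))
  ... | no  k≰2 | yes k≤4 = wide (≢4 (≰⇒> k≰2)) k≤4 (restrict (at-most 4 5) (at-most 4 11) design-5-12-8) design-4-12-12
  ... | _       | no  k≰4 = extended 2 3 (at-most 2 5) (≰⇒> k≰4) k≤11 k≤2+a design-5-12-8

  design-16 : k ≤ 15 → k ≤ 4 + a → (3 < k → width ≢ 4) → Design k k 16 width
  design-16 {k} k≤15 k≤4+a ≢4 with k ≤? 3 | k ≤? 6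
  ... | yes k≤3 | _       = narrow 2 2≤a k≤3 (transpose (copies (divides 2 refl) design-3-4-8))
  ... | no  k≰3 | yes k≤6 = wide (≢4 (≰⇒> k≰3)) k≤6 (restrict (at-most 6 7) (at-most 6 15) design-7-16-8) design-6-16-12
  ... | _       | no  k≰6 = extended 4 3 (at-most 2 7) (≰⇒> k≰6) k≤15 k≤4+a design-7-16-8

  -- As 20 = 8 + 12, arrays of heights 8 and 12 are stacked for 3 ≤ k ≤ 7. An OA(8, k, 2, 2) has k ≤
  -- 7 by Rao's bound, so larger k start from an array of height 20.
  design-20 : k ≤ 19 → k ≤ 2 + a → (2 < k → width ≢ 4) → Design k k 20 width
  design-20 {k} k≤19 k≤2+a ≢4 with k ≤? 2 | k ≤? 4 | k ≤? 7
  ... | yes k≤2 | _       | _       = narrow 2 2≤a k≤2 (transpose (copies (divides 5 refl) (restrict ≤-refl (at-most 2 3) design-2-4-4)))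
  ... | no  k≰2 | yes k≤4 | _       = wide (≢4 (≰⇒> k≰2)) k≤4
          (stack (restrict (at-most 4 5) (at-most 4 7) design-5-8-8) (restrict (at-most 4 5) (at-most 4 11) design-5-12-8))
          (stack (restrict (at-most 4 5) (at-most 4 5) design-5-8-12) design-4-12-12)
  ... | _       | no  k≰4 | yes k≤7 = stack
          -- Height 8 starts at k = 5 rather than 6, with every word occurring twice: 20 has only
          -- two factors 2, so k ≤ 2 + a is all that is given.
          (extended 2 3 (at-most 2 5) (≰⇒> k≰4) k≤7 k≤2+a design-5-8-8)
          (extended 2 3 (at-most 2 5) (≰⇒> k≰4) (≤-trans k≤7 (at-most 7 11)) k≤2+a design-5-12-8)
  ... | _       | _       | no  k≰7 = extended 2 6 (at-most 2 8) (≰⇒> k≰7) k≤19 k≤2+a design-8-20-64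

theorem9 : (m a b k : ℕ) → 1 ≤ m → m ≤ 5 → 1 ≤ b → 2 ∤ b →
    (k , 4 * m , 2 ^ a * b , 2 , 2) ∈ Admissible →
    (k , 4 * m , 2 ^ a * b , 2 , 2) ∉ Exceptional →
    TypeI k (4 * m) (2 ^ a * b) 2 2
theorem9 m a b k 1≤m m≤5 1≤b 2∤b (2^k∣ , (_ , oaM) , (_ , oaN)) ∉exceptional =
  design⇒typeI 2≤k (by-height m 1≤m m≤5 (isOA⇒strength2 oaM) 2^k∣ ∉exceptional)
  where
  width : ℕ
  width = 2 ^ a * b

  2≤k : 2 ≤ k
  2≤k = IsOA.t≤k oaN

  2≤a : 2 ≤ a
  2≤a = 2^k∣2^a*b⇒k≤a 2∤b 2 a (4∣n 2≤k (isOA⇒strength2 oaN))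

  0<width : 0 < width
  0<width = *-mono-≤ (m^n>0 2 a) 1≤b

  width≡4⇒k≤3 : width ≡ 4 → k ≤ 3
  -- Rao's bound starts from a row, which exists because the width is positive.
  width≡4⇒k≤3 ≡4 = s≤s⁻¹ (subst (k <_) ≡4 (k<n 2≤k (isOA⇒strength2 oaN) (fromℕ< 0<width)))

  width≢4 : 3 < k → width ≢ 4
  width≢4 3<k ≡4 = <⇒≱ 3<k (width≡4⇒k≤3 ≡4)

  width≢4-odd : ∀ m → 2 ∤ m → (k , 4 * m , width , 2 , 2) ∉ Exceptional → 2 < k → width ≢ 4
  -- Width 4 and k > 2 force k = 3, the first exceptional family with c = m.
  width≢4-odd m 2∤m ∉exc 2<k ≡4 = ∉exc (m , 2∤m ,
    inj₁ (cong₂ (λ k n → k , 4 * m , n , 2 , 2) (≤-antisym (width≡4⇒k≤3 ≡4) 2<k) ≡4))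

  by-height : ∀ m → 1 ≤ m → m ≤ 5 → {f : Fin (4 * m) → Bits} → Strength2 k f → 2 ^ k ∣ 4 * m * width →
              (k , 4 * m , width , 2 , 2) ∉ Exceptional → Design k k (4 * m) width
  -- With a = 2 and k = 3 the tuple lies in the second exceptional family, with c = b.
  by-height 1 _ _ s d ∉exc = design-4 2≤a 1≤b k≤3 λ 2<k → ≤∧≢⇒< 2≤a λ { refl →
    ∉exc (b , 2∤b , inj₂ (cong (λ k → k , 4 , 4 * b , 2 , 2) (≤-antisym k≤3 2<k))) }
    where
    k≤3 : k ≤ 3
    k≤3 = s≤s⁻¹ (k<n 2≤k s zero)
  -- For even m, k = 3 at width 4 is realised, so width 4 need be excluded only for k > 3, where
  -- Rao's bound does it.
  by-height 2 _ _ s d ∉exc = design-8 2≤a 1≤b (s≤s⁻¹ (k<n 2≤k s zero)) (valuation-bound 3 0 2∤b d) width≢4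
  by-height 3 _ _ s d ∉exc = design-12 2≤a 1≤b (s≤s⁻¹ (k<n 2≤k s zero)) (valuation-bound 2 1 2∤b d)
    (width≢4-odd 3 (toWitnessFalse {a? = 2 ∣? 3} _) ∉exc)
  by-height 4 _ _ s d ∉exc = design-16 2≤a 1≤b (s≤s⁻¹ (k<n 2≤k s zero)) (valuation-bound 4 0 2∤b d) width≢4
  by-height 5 _ _ s d ∉exc = design-20 2≤a 1≤b (s≤s⁻¹ (k<n 2≤k s zero)) (valuation-bound 2 2 2∤b d)
    (width≢4-odd 5 (toWitnessFalse {a? = 2 ∣? 5} _) ∉exc)
  by-height (suc (suc (suc (suc (suc (suc _)))))) _ (s≤s (s≤s (s≤s (s≤s (s≤s ()))))) _ _ _
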